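{- Let $0<q<\frac12$ and let $n\ge 1$ be an integer. Consider the two-phase game with parameters $(q,n)$ described in the context, and let $E_n(q)$ be the conditional expectation of the duration of Phase II given that team B wins. Let $$A_n(q)=\frac{q^n}{1-2q}\sum_{m=0}^{n-1}\binom{n+m-1}{m}(1-q)^m\,(n-m),$$ $$R_n(q)=1-(1-q)^n\sum_{m=0}^{n-1}\binom{n+m-1}{m}q^m+q^n\sum_{m=0}^{n-1}\binom{n+m-1}{m}(1-q)^m .$$ Then $$E_n(q)=\frac{A_n(q)}{R_n(q)}.$$
   Context: The two-phase game with parameters $q\in(0,\frac12)$ and positive integer $n$: two teams, G and B, play; each successive goal is scored by B with probability $q$ and by G with probability $1-q$, independently of all other goals. Phase I: play until G has scored $n$ goals; let $m$ be the number of goals B has scored by then. Phase II: if $m\ge n$, team B is declared the winner immediately (Phase II has duration $0$). If $m<n$, they keep playing until B has caught up and tied the score, in which case B is declared the winner; if B never ties the score, B loses. The duration of Phase II is the number of goals scored (by either team) during Phase II. $R_n(q)$ is the probability that B wins. -}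

module Defs where

open import Algebra.Bundles using (CommutativeRing)
open import Algebra.Apartness.Bundles using (HeytingCommutativeRing; HeytingField)
open import Algebra.Apartness.Structures using (IsHeytingField)
import Algebra.Apartness.Properties.HeytingCommutativeRing as HCRProperties
import Algebra.Properties.CommutativeMonoid.Sum as Summation
import Algebra.Properties.Monoid.Mult as Multiples
import Algebra.Properties.Semiring.Exp as Exponentiation
import Algebra.Properties.Ring as RingProperties
open import Data.Fin.Base using (toℕ)
open import Data.List.Base using (List; []; _∷_; map; foldr; _++_)
open import Data.Maybe.Base using (Maybe; just; nothing; maybe)
open import Data.Nat.Base as ℕ using (ℕ; zero; suc)
open import Data.Nat.Combinatorics using (_C_)
open import Data.Product.Base using (∃-syntax; _×_; _,_; proj₁; proj₂)
open import Data.Sum.Base using (_⊎_; inj₁; inj₂)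
open import Level using (_⊔_) renaming (suc to lsuc)
open import Relation.Binary.Core using (Rel)
open import Relation.Binary.Structures using (IsStrictPartialOrder)

-- The real numbers, given by their axioms: a Cauchy-complete Archimedean
-- ordered field.  Read classically these axioms determine ℝ up to isomorphism;
-- constructively, Bishop's reals satisfy them.  Apartness is not extra data:
-- x # y abbreviates x < y ⊎ y < x.

record RealField c ℓ₁ ℓ₂ : Set (lsuc (c ⊔ ℓ₁ ⊔ ℓ₂)) where
  infix  8 -_
  infixl 7 _*_
  infixl 6 _+_
  infix  4 _≈_ _<_ _#_ _⟶_
  field
    Carrier : Set c
    _≈_     : Rel Carrier ℓ₁
    _<_     : Rel Carrier ℓ₂
    _+_ _*_ : Carrier → Carrier → Carrier
    -_      : Carrier → Carrier
    0# 1#   : Carrier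

  _#_ : Rel Carrier ℓ₂
  x # y = x < y ⊎ y < x

  field
    isHeytingField         : IsHeytingField _≈_ _#_ _+_ _*_ -_ 0# 1#
    <-isStrictPartialOrder : IsStrictPartialOrder _≈_ _<_
    +-monoˡ-<              : ∀ {x y} z → x < y → x + z < y + z
    *-pos                  : ∀ {x y} → 0# < x → 0# < y → 0# < x * y

  heytingField : HeytingField c ℓ₁ ℓ₂
  heytingField = record { isHeytingField = isHeytingField }

  open HeytingField heytingField public
    using (heytingCommutativeRing; tight; #⇒invertible; invertible⇒#; #-cotrans; #-sym)
  open HeytingCommutativeRing heytingCommutativeRing public
    using (commutativeRing)
  open CommutativeRing commutativeRing public
    hiding (Carrier; _≈_; _+_; _*_; -_; 0#; 1#)
  open Exponentiation semiring public using (_^_)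
  open Summation +-commutativeMonoid public using (sum-syntax)
  open Multiples +-monoid public using () renaming (_×_ to _×ₙ_)

  fromℕ : ℕ → Carrier
  fromℕ n = n ×ₙ 1#

  _⟶_ : (ℕ → Carrier) → Carrier → Set (c ⊔ ℓ₂)
  x ⟶ l = ∀ ε → 0# < ε → ∃[ N ] ∀ k → N ℕ.≤ k → (x k - l < ε) × (l - x k < ε)

  IsCauchy : (ℕ → Carrier) → Set (c ⊔ ℓ₂)
  IsCauchy x = ∀ ε → 0# < ε → ∃[ N ] ∀ j k → N ℕ.≤ j → N ℕ.≤ k → x j - x k < ε

  field
    archimedean : ∀ x → ∃[ k ] x < fromℕ k
    complete    : ∀ x → IsCauchy x → ∃[ l ] x ⟶ l

  infixl 7 _/_[_]

  _/_[_] : (x y : Carrier) → y # 0# → Carrier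
  x / y [ y#0 ] = x * proj₁ (#⇒invertible y#0)

module RealFieldProperties {c ℓ₁ ℓ₂} (ℝ : RealField c ℓ₁ ℓ₂) where
  open RealField ℝ
  open HCRProperties heytingCommutativeRing using (1#0; x-0≈x)
  open RingProperties ring using (-‿distribˡ-*; -‿distribʳ-*; -‿involutive)
  open IsStrictPartialOrder <-isStrictPartialOrder public
    using (<-respˡ-≈; <-respʳ-≈) renaming (irrefl to <-irrefl; trans to <-trans)

  x<y⇒0<y-x : ∀ {x y} → x < y → 0# < y - x
  x<y⇒0<y-x {x} x<y = <-respˡ-≈ (-‿inverseʳ x) (+-monoˡ-< (- x) x<y)

  0<1 : 0# < 1#
  0<1 with 1#0
  ... | inj₂ 0<1 = 0<1
  ... | inj₁ 1<0 = <-respʳ-≈ [-1]²≈1 (*-pos 0<-1 0<-1)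
    where
    0<-1 : 0# < - 1#
    0<-1 = <-respʳ-≈ (+-identityˡ (- 1#)) (x<y⇒0<y-x 1<0)

    [-1]²≈1 : - 1# * - 1# ≈ 1#
    [-1]²≈1 = trans (sym (-‿distribˡ-* 1# (- 1#)))
                    (trans (-‿cong (*-identityˡ (- 1#))) (-‿involutive 1#))

  2# : Carrier
  2# = 1# + 1#

  0<2 : 0# < 2#
  0<2 = <-trans 0<1 (<-respˡ-≈ (+-identityˡ 1#) (+-monoˡ-< 1# 0<1))

  2#0 : 2# # 0#
  2#0 = inj₂ 0<2

  ½ : Carrier
  ½ = 1# / 2# [ 2#0 ]

  2*½≈1 : 2# * ½ ≈ 1#
  2*½≈1 = trans (*-congˡ (*-identityˡ _))
         (trans (*-congʳ (sym (x-0≈x 2#)))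
                (proj₂ (proj₂ (#⇒invertible 2#0))))

  q<½⇒1-2q#0 : ∀ {q} → q < ½ → 1# - 2# * q # 0#
  q<½⇒1-2q#0 {q} q<½ = inj₂ (<-respʳ-≈ eq (*-pos 0<2 (x<y⇒0<y-x q<½)))
    where
    eq : 2# * (½ - q) ≈ 1# - 2# * q
    eq = trans (distribˡ 2# ½ (- q)) (+-cong 2*½≈1 (sym (-‿distribʳ-* 2# q)))

data Team : Set where
  G B : Team

-- The goals of a (partial) game, in the order in which they are scored.
History : Set
History = List Team

histories : ℕ → List History
histories zero    = [] ∷ []
histories (suc L) = map (G ∷_) (histories L) ++ map (B ∷_) (histories L)

-- phaseII lead d h: Phase II has lasted d goals, G is ahead by lead, and h is
-- the rest of the history.  The result is just the duration of Phase II when h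
-- brings the game to its end, neither earlier nor later, with B the winner.
phaseII : ℕ → ℕ → History → Maybe ℕ
phaseII zero       d []      = just d
phaseII zero       d (_ ∷ _) = nothing
phaseII (suc lead) d []      = nothing
phaseII (suc lead) d (G ∷ h) = phaseII (suc (suc lead)) (suc d) h
phaseII (suc lead) d (B ∷ h) = phaseII lead (suc d) h

-- phaseI n k m h: G still needs k of its n goals, and B has scored m.  When
-- m ≥ n the lead n ∸ m is zero, so B wins with a Phase II of duration 0.
phaseI : (n k m : ℕ) → History → Maybe ℕ
phaseI n zero    m h       = phaseII (n ℕ.∸ m) 0 h
phaseI n (suc k) m []      = nothing
phaseI n (suc k) m (G ∷ h) = phaseI n k m h
phaseI n (suc k) m (B ∷ h) = phaseI n (suc k) (suc m) h

-- just d if h is a complete game won by B whose Phase II has duration d, and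
-- nothing otherwise.
winDuration : ℕ → History → Maybe ℕ
winDuration n = phaseI n n 0

module TwoPhaseGame {c ℓ₁ ℓ₂} (ℝ : RealField c ℓ₁ ℓ₂) where
  open RealField ℝ public
  open RealFieldProperties ℝ public

  goalProbability : Carrier → Team → Carrier
  goalProbability q G = 1# - q
  goalProbability q B = q

  -- The probability that the successive goals begin with h.
  probability : Carrier → History → Carrier
  probability q = foldr (λ t p → goalProbability q t * p) 1#

  -- Summation over all finite histories, taken in order of length.  It is used
  -- for non-negative terms only, so the order is immaterial.
  HasSum : (History → Carrier) → Carrier → Set (c ⊔ ℓ₂)
  HasSum f s = (λ N → ∑[ L < N ] ∑histories (toℕ L)) ⟶ s
    where
    ∑histories : ℕ → Carrier
    ∑histories L = foldr (λ h → f h +_) 0# (histories L)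

  -- B's victory is the disjoint union, over the complete games h won by B, of
  -- the events that the successive goals begin with h; so its probability, and
  -- the expectation of the duration restricted to it, are sums over such h.

  winTerm : Carrier → ℕ → History → Carrier
  winTerm q n h = maybe (λ _ → probability q h) 0# (winDuration n h)

  durationTerm : Carrier → ℕ → History → Carrier
  durationTerm q n h = maybe (λ d → probability q h * fromℕ d) 0# (winDuration n h)

  -- e is the conditional expectation of the duration of Phase II given that B
  -- wins, 𝔼[duration · 1_win] / ℙ(win); in particular both sums converge.
  record IsConditionalExpectedDuration (q : Carrier) (n : ℕ) (e : Carrier)
         : Set (c ⊔ ℓ₁ ⊔ ℓ₂) where
    field
      ℙ[win]          : Carrier
      𝔼[duration∙win] : Carrier
      ℙ-hasSum        : HasSum (winTerm q n) ℙ[win]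
      𝔼-hasSum        : HasSum (durationTerm q n) 𝔼[duration∙win]
      ℙ[win]#0        : ℙ[win] # 0#
      e≈𝔼/ℙ           : e ≈ 𝔼[duration∙win] / ℙ[win] [ ℙ[win]#0 ]

  A : (q : Carrier) → q < ½ → ℕ → Carrier
  A q q<½ n =
    q ^ n / (1# - 2# * q) [ q<½⇒1-2q#0 q<½ ] *
    (∑[ i < n ] let m = toℕ i in
      fromℕ ((n ℕ.+ m ℕ.∸ 1) C m) * (1# - q) ^ m * fromℕ (n ℕ.∸ m))

  R : Carrier → ℕ → Carrier
  R q n =
    1# - (1# - q) ^ n *
         (∑[ i < n ] let m = toℕ i in fromℕ ((n ℕ.+ m ℕ.∸ 1) C m) * q ^ m)
       + q ^ n *
         (∑[ i < n ] let m = toℕ i in fromℕ ((n ℕ.+ m ℕ.∸ 1) C m) * (1# - q) ^ m)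

{-# OPTIONS --safe #-}
module Submission where

-- For a weight w d = α + β d of the duration d, let T be the claimed expected
-- weight of a win and S_N its part carried by histories shorter than N.  Both obey
-- the first-step recurrence x = p x_G + q x_B, so S_N ≤ T and T ≤ S_N + b_N follow
-- by induction on N as soon as b_N is a supersolution of that recurrence dominating
-- T at N = 0.  Such b_N exist with decay N ρᴺ, ρ = ½ + 2pq < 1; this explicit rate
-- makes the convergence constructive.  With r = q / p, Phase II from lead l has
-- T = rˡ (α + β l / (p - q)), and Phase I weights this by the negative binomial law
-- of B's score.  (α, β) = (1, 0) gives R and (0, 1) gives A.

open import Defs
open import Data.Empty using (⊥; ⊥-elim)
open import Data.Fin.Base using (toℕ)
open import Data.Fin.Properties using (toℕ<n)
open import Data.List.Base using (List; []; _∷_; map; foldr; _++_)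
open import Data.Maybe.Base using (Maybe; just; nothing; maybe)
open import Data.Nat.Base as ℕ using (ℕ; zero; suc; pred; _∸_; z≤n; NonZero)
open import Data.Nat.Combinatorics using (_C_; nCk+nC[k+1]≡[n+1]C[k+1]; k>n⇒nCk≡0)
open import Data.Nat.Properties using (m≤m⊔n; m≤n⊔m; n≤1+n; n<1+n; pred[n]≤n; +-suc; m+[n∸m]≡n; pred[m∸n]≡m∸[1+n]) renaming (+-comm to ℕ-+-comm; ≤-refl to ℕ-≤-refl; <⇒≤ to ℕ-<⇒≤)
open import Data.Product.Base using (Σ-syntax; _×_; _,_; proj₁; proj₂)
open import Data.Sum.Base using (inj₁; inj₂)
open import Function.Bundles using (_⇔_; mk⇔)
open import Relation.Binary.Bundles using (StrictPartialOrder)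
import Algebra.Apartness.Properties.HeytingCommutativeRing as HeytingCommutativeRingProperties
import Algebra.Properties.CommutativeSemiring.Exp as Exponentiation
import Algebra.Properties.Monoid.Mult as Multiples
import Algebra.Properties.Ring as RingProperties
import Algebra.Properties.Semiring.Sum as SemiringSum
import Algebra.Solver.Ring.NaturalCoefficients.Default as NaturalSolver
import Relation.Binary.Construct.StrictToNonStrict as StrictToNonStrict
import Relation.Binary.PropositionalEquality.Core as ≡
import Relation.Binary.Reasoning.Setoid as SetoidReasoning
import Relation.Binary.Reasoning.StrictPartialOrder as StrictReasoning

-- Arithmetic of inequalities and inverses in an ordered Heyting field.

module OrderedFieldProperties {c ℓ₁ ℓ₂} (ℝ : RealField c ℓ₁ ℓ₂) where
  open RealField ℝ
  open RealFieldProperties ℝ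
  open HeytingCommutativeRingProperties heytingCommutativeRing
    using (invertibleˡ⇒#; x-0≈x)
  -- `x ≤ y` is the disjunction of `x < y` and `x ≈ y`, constructively stronger than the negation of
  -- `y < x`. Non-strict bounds are therefore obtained by adding explicit terms whose sign is known.
  open StrictToNonStrict _≈_ _<_ public using (_≤_; <⇒≤)
  open NaturalSolver commutativeSemiring using (solve; _:+_; _:*_; _:=_; con)

  strictPartialOrder : StrictPartialOrder c ℓ₁ ℓ₂
  strictPartialOrder = record { isStrictPartialOrder = <-isStrictPartialOrder }

  module ≤-Reasoning = StrictReasoning strictPartialOrder
  module ≈-Reasoning = SetoidReasoning setoid

  ≤-refl : ∀ {x} → x ≤ x
  ≤-refl = inj₂ refl

  ≤-trans : ∀ {x y z} → x ≤ y → y ≤ z → x ≤ z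
  ≤-trans {x} {y} {z} x≤y y≤z = begin
    x ≤⟨ x≤y ⟩
    y ≤⟨ y≤z ⟩
    z ∎
    where open ≤-Reasoning

  <-asym : ∀ {x y} → x < y → y < x → ∀ {a} {P : Set a} → P
  <-asym x<y y<x = ⊥-elim (<-irrefl refl (<-trans x<y y<x))

  x+[y-x]≈y : ∀ x y → x + (y - x) ≈ y
  x+[y-x]≈y x y = begin
    x + (y - x) ≈⟨ +-congˡ (+-comm y (- x)) ⟩
    x + (- x + y) ≈⟨ +-assoc x (- x) y ⟨
    x - x + y ≈⟨ +-congʳ (-‿inverseʳ x) ⟩
    0# + y ≈⟨ +-identityˡ y ⟩
    y ∎
    where open ≈-Reasoning

  +-monoʳ-< : ∀ {x y} z → x < y → z + x < z + y
  +-monoʳ-< {x} {y} z x<y = <-respˡ-≈ (+-comm x z) (<-respʳ-≈ (+-comm y z) (+-monoˡ-< z x<y))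

  x<x+y : ∀ x {y} → 0# < y → x < x + y
  x<x+y x 0<y = <-respˡ-≈ (+-identityʳ x) (+-monoʳ-< x 0<y)

  +-mono-≤ : ∀ {x y u v} → x ≤ y → u ≤ v → x + u ≤ y + v
  +-mono-≤ {x} {y} {u} {v} x≤y u≤v = ≤-trans (left x≤y) (right u≤v)
    where
    left : x ≤ y → x + u ≤ y + u
    left (inj₁ x<y) = inj₁ (+-monoˡ-< u x<y)
    left (inj₂ x≈y) = inj₂ (+-congʳ x≈y)
    right : u ≤ v → y + u ≤ y + v
    right (inj₁ u<v) = inj₁ (+-monoʳ-< y u<v)
    right (inj₂ u≈v) = inj₂ (+-congˡ u≈v)

  x≤x+y : ∀ x {y} → 0# ≤ y → x ≤ x + y
  x≤x+y x (inj₁ 0<y) = inj₁ (x<x+y x 0<y)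
  x≤x+y x (inj₂ 0≈y) = inj₂ (trans (sym (+-identityʳ x)) (+-congˡ 0≈y))

  +-nonNeg : ∀ {x y} → 0# ≤ x → 0# ≤ y → 0# ≤ x + y
  +-nonNeg {x} 0≤x 0≤y = ≤-trans 0≤x (x≤x+y x 0≤y)

  +-pos : ∀ {x y} → 0# < x → 0# < y → 0# < x + y
  +-pos {x} 0<x 0<y = <-trans 0<x (x<x+y x 0<y)

  *-monoʳ-< : ∀ {x y} z → 0# < z → x < y → z * x < z * y
  *-monoʳ-< {x} {y} z 0<z x<y = <-respʳ-≈ eq (x<x+y (z * x) (*-pos 0<z (x<y⇒0<y-x x<y)))
    where
    eq : z * x + z * (y - x) ≈ z * y
    eq = trans (sym (distribˡ z x (y - x))) (*-congˡ (x+[y-x]≈y x y))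

  *-monoʳ-≤ : ∀ {x y} z → 0# ≤ z → x ≤ y → z * x ≤ z * y
  *-monoʳ-≤ z (inj₁ 0<z) (inj₁ x<y) = inj₁ (*-monoʳ-< z 0<z x<y)
  *-monoʳ-≤ z (inj₁ 0<z) (inj₂ x≈y) = inj₂ (*-congˡ x≈y)
  *-monoʳ-≤ {x} {y} z (inj₂ 0≈z) x≤y = inj₂ (trans (vanish x) (sym (vanish y)))
    where
    vanish : ∀ u → z * u ≈ 0#
    vanish u = trans (*-congʳ (sym 0≈z)) (zeroˡ u)

  *-monoˡ-≤ : ∀ {x y} z → 0# ≤ z → x ≤ y → x * z ≤ y * z
  *-monoˡ-≤ {x} {y} z 0≤z x≤y = begin
    x * z ≈⟨ *-comm x z ⟩
    z * x ≤⟨ *-monoʳ-≤ z 0≤z x≤y ⟩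
    z * y ≈⟨ *-comm z y ⟩
    y * z ∎
    where open ≤-Reasoning

  *-mono-≤ : ∀ {x y u v} → 0# ≤ y → 0# ≤ u → x ≤ y → u ≤ v → x * u ≤ y * v
  *-mono-≤ {y = y} {u} 0≤y 0≤u x≤y u≤v =
    ≤-trans (*-monoˡ-≤ u 0≤u x≤y) (*-monoʳ-≤ y 0≤y u≤v)

  *-nonNeg : ∀ {x y} → 0# ≤ x → 0# ≤ y → 0# ≤ x * y
  *-nonNeg {x} {y} 0≤x 0≤y = ≤-trans (inj₂ (sym (zeroʳ x))) (*-monoʳ-≤ x 0≤x 0≤y)

  -- An invertible element is apart from 0, so its sign is decided; a negative `y` would give
  -- `1# < 0#`.
  inverse-pos : ∀ {x y} → 0# < x → x * y ≈ 1# → 0# < y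
  inverse-pos {x} {y} 0<x xy≈1
    with invertibleˡ⇒# {y} {0#} (x , trans (*-congˡ (x-0≈x y)) xy≈1)
  ... | inj₂ 0<y = 0<y
  ... | inj₁ y<0 = <-asym 0<1 1<0
    where
    1<0 : 1# < 0#
    1<0 = <-respˡ-≈ xy≈1 (<-respʳ-≈ (zeroʳ x) (*-monoʳ-< x 0<x y<0))

  *-inverseʳ : ∀ {x} (x#0 : x # 0#) → x * proj₁ (#⇒invertible x#0) ≈ 1#
  *-inverseʳ {x} x#0 = trans (*-congʳ (sym (x-0≈x x))) (proj₂ (proj₂ (#⇒invertible x#0)))

  inverse-cancelˡ : ∀ {x u} → u * x ≈ 1# → ∀ y → u * (x * y) ≈ y
  inverse-cancelˡ {x} {u} ux≈1 y =
    trans (sym (*-assoc u x y)) (trans (*-congʳ ux≈1) (*-identityˡ y))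

  invertible-cancelˡ : ∀ {x u y z} → u * x ≈ 1# → x * y ≈ x * z → y ≈ z
  invertible-cancelˡ {y = y} {z} ux≈1 xy≈xz =
    trans (sym (inverse-cancelˡ ux≈1 y)) (trans (*-congˡ xy≈xz) (inverse-cancelˡ ux≈1 z))

  *-cancelˡ-< : ∀ {x y z} → 0# < x → x * y < x * z → y < z
  *-cancelˡ-< {x} {y} {z} 0<x xy<xz =
    <-respˡ-≈ (inverse-cancelˡ ux≈1 y) (<-respʳ-≈ (inverse-cancelˡ ux≈1 z)
      (*-monoʳ-< u (inverse-pos 0<x xu≈1) xy<xz))
    where
    u = proj₁ (#⇒invertible {x} {0#} (inj₂ 0<x))
    xu≈1 : x * u ≈ 1#
    xu≈1 = *-inverseʳ (inj₂ 0<x)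
    ux≈1 : u * x ≈ 1#
    ux≈1 = trans (*-comm u x) xu≈1

  -- The chosen inverse depends on the apartness proof, but inverses of equal elements agree by
  -- cancellation.
  /-cong : ∀ {x x′ y y′} (y#0 : y # 0#) (y′#0 : y′ # 0#) → x ≈ x′ → y ≈ y′ →
           x / y [ y#0 ] ≈ x′ / y′ [ y′#0 ]
  /-cong {x} {x′} {y} {y′} y#0 y′#0 x≈x′ y≈y′ = *-cong x≈x′
    (invertible-cancelˡ (trans (*-comm _ y) (*-inverseʳ y#0))
      (trans (*-inverseʳ y#0) (sym (trans (*-congʳ y≈y′) (*-inverseʳ y′#0)))))

  0<½ : 0# < ½
  0<½ = inverse-pos 0<2 2*½≈1

  ^-pos : ∀ {x} → 0# < x → ∀ n → 0# < x ^ n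
  ^-pos 0<x zero    = 0<1
  ^-pos 0<x (suc n) = *-pos 0<x (^-pos 0<x n)

  ^-mono-≤ : ∀ {x y} → 0# < x → x ≤ y → ∀ n → x ^ n ≤ y ^ n
  ^-mono-≤ 0<x x≤y zero    = ≤-refl
  ^-mono-≤ {x} {y} 0<x x≤y (suc n) =
    *-mono-≤ (≤-trans (<⇒≤ 0<x) x≤y) (<⇒≤ (^-pos 0<x n)) x≤y (^-mono-≤ 0<x x≤y n)

  1^n≈1 : ∀ n → 1# ^ n ≈ 1#
  1^n≈1 zero    = refl
  1^n≈1 (suc n) = trans (*-identityˡ _) (1^n≈1 n)

  fromℕ-nonNeg : ∀ n → 0# ≤ fromℕ n
  fromℕ-nonNeg zero    = ≤-refl
  fromℕ-nonNeg (suc n) = +-nonNeg (<⇒≤ 0<1) (fromℕ-nonNeg n)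

  fromℕ-mono-≤ : ∀ {m n} → m ℕ.≤ n → fromℕ m ≤ fromℕ n
  fromℕ-mono-≤ {n = n} ℕ.z≤n = fromℕ-nonNeg n
  fromℕ-mono-≤ (ℕ.s≤s m≤n)   = +-mono-≤ ≤-refl (fromℕ-mono-≤ m≤n)

  -- In the inductive step the two sides differ by the non-negative term `fromℕ n * x * x`.
  bernoulli : ∀ {x} → 0# ≤ x → ∀ n → 1# + fromℕ n * x ≤ (1# + x) ^ n
  bernoulli {x} 0≤x zero    = inj₂ (trans (+-congˡ (zeroˡ x)) (+-identityʳ 1#))
  bernoulli {x} 0≤x (suc n) = begin
    1# + (1# + fromℕ n) * x                        ≤⟨ x≤x+y _ (*-nonNeg (*-nonNeg (fromℕ-nonNeg n) 0≤x) 0≤x) ⟩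
    1# + (1# + fromℕ n) * x + fromℕ n * x * x
      ≈⟨ solve 2 (λ x n → con 1 :+ (con 1 :+ n) :* x :+ n :* x :* x
                       := (con 1 :+ x) :* (con 1 :+ n :* x)) refl x (fromℕ n) ⟩
    (1# + x) * (1# + fromℕ n * x)                  ≤⟨ *-monoʳ-≤ (1# + x) (+-nonNeg (<⇒≤ 0<1) 0≤x) (bernoulli 0≤x n) ⟩
    (1# + x) * (1# + x) ^ n                        ∎
    where open ≤-Reasoning

  x<y+z⇒x-y<z : ∀ {x y z} → x < y + z → x - y < z
  x<y+z⇒x-y<z {x} {y} {z} x<y+z = <-respʳ-≈ eq (+-monoˡ-< (- y) x<y+z)
    where
    eq : y + z - y ≈ z
    eq = trans (+-congʳ (+-comm y z)) (trans (+-assoc z y (- y))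
           (trans (+-congˡ (-‿inverseʳ y)) (+-identityʳ z)))

  x-y<z⇒x<y+z : ∀ {x y z} → x - y < z → x < y + z
  x-y<z⇒x<y+z {x} {y} x-y<z = <-respˡ-≈ (x+[y-x]≈y y x) (+-monoʳ-< y x-y<z)

  -- Limits: squeezing, uniqueness and an explicit rate of decay.

  Null : (ℕ → Carrier) → Set _
  Null b = ∀ ε → 0# < ε → Σ[ N ∈ ℕ ] (∀ k → N ℕ.≤ k → b k < ε)

  squeeze : ∀ {x b l} → (∀ k → x k ≤ l) → (∀ k → l ≤ x k + b k) → Null b → x ⟶ l
  squeeze {x} {b} {l} x≤l l≤x+b null ε 0<ε = proj₁ (null ε 0<ε) , λ k N≤k →
      x<y+z⇒x-y<z (begin-strict
        x k   ≤⟨ x≤l k ⟩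
        l     <⟨ x<x+y l 0<ε ⟩
        l + ε ∎)
    , x<y+z⇒x-y<z (begin-strict
        l         ≤⟨ l≤x+b k ⟩
        x k + b k <⟨ +-monoʳ-< (x k) (proj₂ (null ε 0<ε) k N≤k) ⟩
        x k + ε   ∎)
    where open ≤-Reasoning

  ⟶-cong : ∀ {x y l m} → (∀ k → x k ≈ y k) → l ≈ m → x ⟶ l → y ⟶ m
  ⟶-cong x≈y l≈m x⟶l ε 0<ε = proj₁ (x⟶l ε 0<ε) , λ k N≤k →
    let x-l<ε , l-x<ε = proj₂ (x⟶l ε 0<ε) k N≤k in
      <-respˡ-≈ (+-cong (x≈y k) (-‿cong l≈m)) x-l<ε
    , <-respˡ-≈ (+-cong l≈m (-‿cong (x≈y k))) l-x<ε

  -- By tightness it suffices to refute apartness. If `l < m`, a common index at which both errors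
  -- are below half the gap gives `m < m`.
  ⟶-unique : ∀ {x l m} → x ⟶ l → x ⟶ m → l ≈ m
  ⟶-unique {x} x⟶l x⟶m = proj₁ (tight _ _) λ
    { (inj₁ l<m) → apart x⟶l x⟶m l<m
    ; (inj₂ m<l) → apart x⟶m x⟶l m<l }
    where
    apart : ∀ {l m} → x ⟶ l → x ⟶ m → l < m → ⊥
    apart {l} {m} x⟶l x⟶m l<m = <-irrefl refl (begin-strict
      m             <⟨ x-y<z⇒x<y+z (proj₂ (proj₂ (x⟶m ε 0<ε) k (m≤n⊔m M N))) ⟩
      x k + ε       <⟨ +-monoˡ-< ε (x-y<z⇒x<y+z (proj₁ (proj₂ (x⟶l ε 0<ε) k (m≤m⊔n M N)))) ⟩
      l + ε + ε     ≈⟨ +-assoc l ε ε ⟩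
      l + (ε + ε)   ≈⟨ +-congˡ ε+ε≈m-l ⟩
      l + (m - l)   ≈⟨ x+[y-x]≈y l m ⟩
      m             ∎)
      where
      open ≤-Reasoning
      ε = ½ * (m - l)
      0<ε = *-pos 0<½ (x<y⇒0<y-x l<m)
      M = proj₁ (x⟶l ε 0<ε)
      N = proj₁ (x⟶m ε 0<ε)
      k = M ℕ.⊔ N
      ε+ε≈m-l : ε + ε ≈ m - l
      ε+ε≈m-l = trans (solve 2 (λ h d → h :* d :+ h :* d := (con 1 :+ con 1) :* h :* d) refl ½ (m - l))
                      (trans (*-congʳ 2*½≈1) (*-identityˡ _))

  -- ρᵏ (1 + kτ)² ≤ 1 by Bernoulli, so b k (1 + kτ) ≤ K.
  null-of-geometric : ∀ {b ρ τ K} → 0# < ρ → 0# < τ → 0# ≤ K →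
    ρ * ((1# + τ) * (1# + τ)) ≤ 1# →
    (∀ k → b k ≤ ρ ^ k * (K * (1# + fromℕ k * τ))) → Null b
  null-of-geometric {b} {ρ} {τ} {K} 0<ρ 0<τ 0≤K ρ[1+τ]²≤1 b≤ ε 0<ε = N , bound
    where
    open ≤-Reasoning
    ετ = ε * τ
    0<ετ = *-pos 0<ε 0<τ
    v = proj₁ (#⇒invertible {ετ} {0#} (inj₂ 0<ετ))
    -- A natural number above `K / (ε * τ)`: for `k` from `N` on, `K < ε * (1# + fromℕ k * τ)`.
    N = proj₁ (archimedean (v * K))

    μ = 1# + τ
    0<μ = +-pos 0<1 0<τ

    ρᵏμ²ᵏ≤1 : ∀ k → ρ ^ k * (μ ^ k * μ ^ k) ≤ 1#
    ρᵏμ²ᵏ≤1 zero    = inj₂ (trans (*-identityˡ _) (*-identityˡ _))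
    ρᵏμ²ᵏ≤1 (suc k) = begin
      ρ * ρ ^ k * (μ * μ ^ k * (μ * μ ^ k))
        ≈⟨ solve 4 (λ ρ r μ m → ρ :* r :* (μ :* m :* (μ :* m)) := ρ :* (μ :* μ) :* (r :* (m :* m)))
             refl ρ (ρ ^ k) μ (μ ^ k) ⟩
      ρ * (μ * μ) * (ρ ^ k * (μ ^ k * μ ^ k))
        ≤⟨ *-mono-≤ (<⇒≤ 0<1) (<⇒≤ (*-pos (^-pos 0<ρ k) (*-pos (^-pos 0<μ k) (^-pos 0<μ k))))
             ρ[1+τ]²≤1 (ρᵏμ²ᵏ≤1 k) ⟩
      1# * 1# ≈⟨ *-identityˡ 1# ⟩
      1# ∎

    bound : ∀ k → N ℕ.≤ k → b k < ε
    bound k N≤k = *-cancelˡ-< 0<y (begin-strict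
      y * b k                 ≤⟨ *-monoʳ-≤ y (<⇒≤ 0<y) (b≤ k) ⟩
      y * (ρ ^ k * (K * y))   ≈⟨ solve 3 (λ y r K → y :* (r :* (K :* y)) := K :* (r :* (y :* y))) refl y (ρ ^ k) K ⟩
      K * (ρ ^ k * (y * y))   ≤⟨ *-monoʳ-≤ K 0≤K (*-monoʳ-≤ (ρ ^ k) (<⇒≤ (^-pos 0<ρ k))
                                   (*-mono-≤ (<⇒≤ (^-pos 0<μ k)) (<⇒≤ 0<y) y≤μᵏ y≤μᵏ)) ⟩
      K * (ρ ^ k * (μ ^ k * μ ^ k)) ≤⟨ *-monoʳ-≤ K 0≤K (ρᵏμ²ᵏ≤1 k) ⟩
      K * 1#                  ≈⟨ *-identityʳ K ⟩
      K                       ≈⟨ *-identityˡ K ⟨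
      1# * K                  ≈⟨ *-congʳ (*-inverseʳ (inj₂ 0<ετ)) ⟨
      ετ * v * K              ≈⟨ *-assoc ετ v K ⟩
      ετ * (v * K)            <⟨ *-monoʳ-< ετ 0<ετ (proj₂ (archimedean (v * K))) ⟩
      ετ * fromℕ N            ≤⟨ *-monoʳ-≤ ετ (<⇒≤ 0<ετ) (fromℕ-mono-≤ N≤k) ⟩
      ετ * fromℕ k            ≤⟨ x≤x+y _ (<⇒≤ 0<ε) ⟩
      ετ * fromℕ k + ε        ≈⟨ solve 3 (λ ε τ k → ε :* τ :* k :+ ε := (con 1 :+ k :* τ) :* ε) refl ε τ (fromℕ k) ⟩
      y * ε                   ∎)
      where
      y = 1# + fromℕ k * τ
      0<y : 0# < y
      0<y = begin-strict
        0# <⟨ 0<1 ⟩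
        1# ≤⟨ x≤x+y 1# (*-nonNeg (fromℕ-nonNeg k) (<⇒≤ 0<τ)) ⟩
        y  ∎
      y≤μᵏ = bernoulli (<⇒≤ 0<τ) k

-- Sums over histories and their first-step recurrences.

module HistorySums {c ℓ₁ ℓ₂} (ℝ : RealField c ℓ₁ ℓ₂) where
  open TwoPhaseGame ℝ
  open SemiringSum semiring using (sum-cong-≋; ∑-distrib-+; *-distribˡ-sum)
  open OrderedFieldProperties ℝ using (⟶-cong)

  sumList : (History → Carrier) → List History → Carrier
  sumList f = foldr (λ h → f h +_) 0#

  sumList-++ : ∀ f xs ys → sumList f (xs ++ ys) ≈ sumList f xs + sumList f ys
  sumList-++ f []       ys = sym (+-identityˡ _)
  sumList-++ f (x ∷ xs) ys = trans (+-congˡ (sumList-++ f xs ys)) (sym (+-assoc _ _ _))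

  sumList-map : ∀ f (g : History → History) xs → sumList f (map g xs) ≈ sumList (λ h → f (g h)) xs
  sumList-map f g []       = refl
  sumList-map f g (x ∷ xs) = +-congˡ (sumList-map f g xs)

  sumList-cong : ∀ {f g} → (∀ h → f h ≈ g h) → ∀ xs → sumList f xs ≈ sumList g xs
  sumList-cong f≈g []       = refl
  sumList-cong f≈g (x ∷ xs) = +-cong (f≈g x) (sumList-cong f≈g xs)

  sumList-* : ∀ a f xs → sumList (λ h → a * f h) xs ≈ a * sumList f xs
  sumList-* a f []       = sym (zeroʳ a)
  sumList-* a f (x ∷ xs) = trans (+-congˡ (sumList-* a f xs)) (sym (distribˡ a _ _))

  -- Unfolds to the same term as the sequence inside `HasSum`, so `HasSum f s` is definitionally the
  -- convergence of `partialSum f` to `s`.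
  partialSum : (History → Carrier) → ℕ → Carrier
  partialSum f N = ∑[ L < N ] sumList f (histories (toℕ L))

  partialSum-cong : ∀ {f g} → (∀ h → f h ≈ g h) → ∀ N → partialSum f N ≈ partialSum g N
  partialSum-cong f≈g N = sum-cong-≋ {N} (λ L → sumList-cong f≈g (histories (toℕ L)))

  partialSum-* : ∀ a f N → partialSum (λ h → a * f h) N ≈ a * partialSum f N
  partialSum-* a f N = trans (sum-cong-≋ {N} (λ L → sumList-* a f (histories (toℕ L))))
    (sym (*-distribˡ-sum {N} a (λ L → sumList f (histories (toℕ L)))))

  -- A non-empty history of length at most `N` is a first goal followed by a history shorter than
  -- `N`.
  partialSum-suc : ∀ f N → partialSum f (suc N) ≈
    f [] + (partialSum (λ h → f (G ∷ h)) N + partialSum (λ h → f (B ∷ h)) N)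
  partialSum-suc f N = +-cong (+-identityʳ (f []))
    (trans (sum-cong-≋ {N} (λ L → step (toℕ L)))
           (∑-distrib-+ {N} (λ L → sumList _ (histories (toℕ L))) (λ L → sumList _ (histories (toℕ L)))))
    where
    step : ∀ L → sumList f (histories (suc L)) ≈
           sumList (λ h → f (G ∷ h)) (histories L) + sumList (λ h → f (B ∷ h)) (histories L)
    step L = trans (sumList-++ f (map (G ∷_) (histories L)) (map (B ∷_) (histories L)))
                   (+-cong (sumList-map f (G ∷_) (histories L)) (sumList-map f (B ∷_) (histories L)))

  HasSum-cong : ∀ {f g s} → (∀ h → f h ≈ g h) → HasSum f s → HasSum g s
  HasSum-cong f≈g = ⟶-cong (partialSum-cong f≈g) refl

  module _ (q : Carrier) (w : ℕ → Carrier) where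

    -- The outcome `D` is an arbitrary function, so that removing a first goal `t` gives an outcome
    -- of the same kind, `λ h → D (t ∷ h)`. For `phaseI` and `phaseII` this reduces to the next
    -- state of the game.
    weighted : (History → Maybe ℕ) → History → Carrier
    weighted D h = maybe (λ d → probability q h * w d) 0# (D h)

    weightedSum : (History → Maybe ℕ) → ℕ → Carrier
    weightedSum D = partialSum (weighted D)

    weighted-∷ : ∀ D t h → weighted D (t ∷ h) ≈ goalProbability q t * weighted (λ h → D (t ∷ h)) h
    weighted-∷ D t h with D (t ∷ h)
    ... | just d  = *-assoc _ _ _
    ... | nothing = sym (zeroʳ _)

    weightedSum-suc : ∀ D N → weightedSum D (suc N) ≈ weighted D [] +
      ((1# - q) * weightedSum (λ h → D (G ∷ h)) N + q * weightedSum (λ h → D (B ∷ h)) N)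
    weightedSum-suc D N = trans (partialSum-suc (weighted D) N) (+-congˡ (+-cong (tail G) (tail B)))
      where
      tail : ∀ t → partialSum (λ h → weighted D (t ∷ h)) N ≈
             goalProbability q t * weightedSum (λ h → D (t ∷ h)) N
      tail t = trans (partialSum-cong (weighted-∷ D t) N) (partialSum-* _ _ N)

    mix-zero : ∀ a b {x} → x ≈ 0# → a * x + b * x ≈ 0#
    mix-zero a b x≈0 = trans (+-cong (trans (*-congˡ x≈0) (zeroʳ a)) (trans (*-congˡ x≈0) (zeroʳ b)))
                             (+-identityˡ 0#)

    weightedSum-nothing : ∀ N → weightedSum (λ _ → nothing) N ≈ 0#
    weightedSum-nothing zero    = refl
    weightedSum-nothing (suc N) = trans (weightedSum-suc (λ _ → nothing) N)
      (trans (+-identityˡ _) (mix-zero _ _ (weightedSum-nothing N)))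

    phaseIISum : ℕ → ℕ → ℕ → Carrier
    phaseIISum l d = weightedSum (phaseII l d)

    -- The game stops at a tie: the empty history carries the whole weight, and every longer one
    -- gives `nothing`.
    phaseIISum-tied : ∀ d N → phaseIISum 0 d (suc N) ≈ w d
    phaseIISum-tied d N = trans (weightedSum-suc (phaseII 0 d) N)
      (trans (+-cong (*-identityˡ (w d)) (mix-zero _ _ (weightedSum-nothing N))) (+-identityʳ (w d)))

    phaseIISum-suc : ∀ l d N → phaseIISum (suc l) d (suc N) ≈
      (1# - q) * phaseIISum (suc (suc l)) (suc d) N + q * phaseIISum l (suc d) N
    phaseIISum-suc l d N = trans (weightedSum-suc (phaseII (suc l) d) N) (+-identityˡ _)

    phaseISum : ℕ → ℕ → ℕ → ℕ → Carrier
    phaseISum n k m = weightedSum (phaseI n k m)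

    phaseISum-suc : ∀ n k m N → phaseISum n (suc k) m (suc N) ≈
      (1# - q) * phaseISum n k m N + q * phaseISum n (suc k) (suc m) N
    phaseISum-suc n k m N = trans (weightedSum-suc (phaseI n (suc k) m) N) (+-identityˡ _)

-- Constants of the biased walk and the inequalities between them.

module WinningGame {c ℓ₁ ℓ₂} (ℝ : RealField c ℓ₁ ℓ₂) (q : RealField.Carrier ℝ)
  (0<q : RealField._<_ ℝ (RealField.0# ℝ) q)
  (q<½ : RealField._<_ ℝ q (RealFieldProperties.½ ℝ)) where

  open TwoPhaseGame ℝ
  open OrderedFieldProperties ℝ
  open HistorySums ℝ
  open RingProperties ring using (+-cancelˡ; +-cancelʳ)
  open SemiringSum semiring using (sum-cong-≋; sum-replicate-zero; ∑-distrib-+; *-distribˡ-sum)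
  open Multiples +-monoid using (×-congˡ; ×-homo-+)
  open Exponentiation commutativeSemiring using (^-congˡ; ^-congʳ; ^-homo-*; ^-distrib-*)
  open NaturalSolver commutativeSemiring using (solve; _:+_; _:*_; _:=_; con)

  -- `δ` equals `p - q` and `v` is its inverse. The rate `p * s + q / s` is below 1 when `s` lies
  -- strictly between the roots `q / p` and 1 of `p x² - x + q`; `s = 2q` does, and turns the rate
  -- into `ρ`. `τ` is half of `1 - ρ`.
  p δ v s ρ τ : Carrier
  p = 1# - q
  δ = 1# - 2# * q
  v = proj₁ (#⇒invertible (q<½⇒1-2q#0 q<½))
  s = 2# * q
  ρ = ½ + 2# * (p * q)
  τ = ½ * ½ * (δ * δ)

  0<δ : 0# < δ
  0<δ = x<y⇒0<y-x (<-respʳ-≈ 2*½≈1 (*-monoʳ-< 2# 0<2 q<½))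

  s+δ≈1 : s + δ ≈ 1#
  s+δ≈1 = x+[y-x]≈y s 1#

  p+q≈1 : p + q ≈ 1#
  p+q≈1 = trans (+-comm p q) (x+[y-x]≈y q 1#)

  -- The solver works in commutative semirings. Writing `p` as `q + δ` and `1#` as `s + δ` turns the
  -- identities below into subtraction-free ones.
  p≈q+δ : p ≈ q + δ
  p≈q+δ = +-cancelˡ q p (q + δ) (begin
    q + p       ≈⟨ x+[y-x]≈y q 1# ⟩
    1#          ≈⟨ s+δ≈1 ⟨
    s + δ       ≈⟨ solve 2 (λ q δ → (con 1 :+ con 1) :* q :+ δ := q :+ (q :+ δ)) refl q δ ⟩
    q + (q + δ) ∎)
    where open ≈-Reasoning

  δv≈1 : δ * v ≈ 1#
  δv≈1 = *-inverseʳ (q<½⇒1-2q#0 q<½)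

  0<v : 0# < v
  0<v = inverse-pos 0<δ δv≈1

  0<p : 0# < p
  0<p = <-respʳ-≈ (sym p≈q+δ) (+-pos 0<q 0<δ)

  r : Carrier
  r = q / p [ inj₂ 0<p ]

  pr≈q : p * r ≈ q
  pr≈q = trans (solve 3 (λ p q u → p :* (q :* u) := p :* u :* q) refl p q _)
               (trans (*-congʳ (*-inverseʳ (inj₂ 0<p))) (*-identityˡ q))

  0<r : 0# < r
  0<r = *-cancelˡ-< 0<p (<-respˡ-≈ (sym (zeroʳ p)) (<-respʳ-≈ (sym pr≈q) 0<q))

  0<s : 0# < s
  0<s = *-pos 0<2 0<q

  0<ρ : 0# < ρ
  0<ρ = +-pos 0<½ (*-pos 0<2 (*-pos 0<p 0<q))

  0<τ : 0# < τ
  0<τ = *-pos (*-pos 0<½ 0<½) (*-pos 0<δ 0<δ)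

  s≤1 : s ≤ 1#
  s≤1 = ≤-trans (x≤x+y s (<⇒≤ 0<δ)) (inj₂ s+δ≈1)

  -- After multiplication by `p` the gap is `2pq - q = q * δ`.
  r≤s : r ≤ s
  r≤s = <⇒≤ (*-cancelˡ-< 0<p (begin-strict
    p * r               ≈⟨ pr≈q ⟩
    q                   <⟨ x<x+y q (*-pos 0<q 0<δ) ⟩
    q + q * δ           ≈⟨ +-congʳ (trans (*-congˡ s+δ≈1) (*-identityʳ q)) ⟨
    q * (s + δ) + q * δ ≈⟨ solve 2 (λ q δ → q :* ((con 1 :+ con 1) :* q :+ δ) :+ q :* δ
                                    := (q :+ δ) :* ((con 1 :+ con 1) :* q)) refl q δ ⟩
    (q + δ) * s         ≈⟨ *-congʳ p≈q+δ ⟨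
    p * s               ∎))
    where open ≤-Reasoning

  ρs≈ps²+q : ρ * s ≈ p * (s * s) + q
  ρs≈ps²+q = begin
    ρ * s                      ≈⟨ solve 3 (λ h p q → let two = con 1 :+ con 1 in
                                    (h :+ two :* (p :* q)) :* (two :* q)
                                    := p :* (two :* q :* (two :* q)) :+ two :* h :* q) refl ½ p q ⟩
    p * (s * s) + 2# * ½ * q   ≈⟨ +-congˡ (trans (*-congʳ 2*½≈1) (*-identityˡ q)) ⟩
    p * (s * s) + q            ∎
    where open ≈-Reasoning

  -- Because `1 - 4pq = δ²`. This is the exact slack in `p s² ≤ q`.
  q≈ps²+qδ² : q ≈ p * (s * s) + q * (δ * δ)
  q≈ps²+qδ² = begin
    q                             ≈⟨ *-identityʳ q ⟨
    q * 1#                        ≈⟨ *-congˡ (*-identityˡ 1#) ⟨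
    q * (1# * 1#)                 ≈⟨ *-congˡ (*-cong s+δ≈1 s+δ≈1) ⟨
    q * ((s + δ) * (s + δ))       ≈⟨ solve 2 (λ q δ → let s = (con 1 :+ con 1) :* q in
                                       q :* ((s :+ δ) :* (s :+ δ))
                                       := (q :+ δ) :* (s :* s) :+ q :* (δ :* δ)) refl q δ ⟩
    (q + δ) * (s * s) + q * (δ * δ) ≈⟨ +-congʳ (*-congʳ p≈q+δ) ⟨
    p * (s * s) + q * (δ * δ)     ∎
    where open ≈-Reasoning

  -- The gap is `q (4p - 1) = q + 2qδ`.
  p+2q≤2ρ : p + 2# * q ≤ 2# * ρ
  p+2q≤2ρ = begin
    p + 2# * q                    ≈⟨ solve 2 (λ p q → p :+ (con 1 :+ con 1) :* q := p :+ q :+ q) refl p q ⟩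
    p + q + q                     ≈⟨ +-congʳ p+q≈1 ⟩
    1# + q                        ≤⟨ x≤x+y _ (+-nonNeg (<⇒≤ 0<q) (<⇒≤ (*-pos 0<q (*-pos 0<2 0<δ)))) ⟩
    1# + q + (q + q * (2# * δ))   ≈⟨ solve 2 (λ q δ → let two = con 1 :+ con 1 in
                                       con 1 :+ q :+ (q :+ q :* (two :* δ))
                                       := con 1 :+ q :* (two :* con 1 :+ two :* δ)) refl q δ ⟩
    1# + q * (2# * 1# + 2# * δ)   ≈⟨ +-cong 2*½≈1 (*-congˡ (+-congʳ (*-congˡ s+δ≈1))) ⟨
    2# * ½ + q * (2# * (s + δ) + 2# * δ) ≈⟨ solve 3 (λ h q δ → let two = con 1 :+ con 1 in
                                       two :* h :+ q :* (two :* (two :* q :+ δ) :+ two :* δ)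
                                       := two :* (h :+ two :* ((q :+ δ) :* q))) refl ½ q δ ⟩
    2# * (½ + 2# * ((q + δ) * q)) ≈⟨ *-congˡ (+-congˡ (*-congˡ (*-congʳ p≈q+δ))) ⟨
    2# * ρ                        ∎
    where open ≤-Reasoning

  ρ+2τ≈1 : ρ + 2# * τ ≈ 1#
  ρ+2τ≈1 = begin
    ½ + 2# * (p * q) + 2# * τ         ≈⟨ +-congʳ (+-congˡ (*-congˡ (*-congʳ p≈q+δ))) ⟩
    ½ + 2# * ((q + δ) * q) + 2# * τ   ≈⟨ +-congʳ (+-congˡ (trans (*-congʳ 2*½≈1) (*-identityˡ _))) ⟨
    ½ + 2# * ½ * (2# * ((q + δ) * q)) + 2# * τ
      ≈⟨ solve 3 (λ h q δ → let two = con 1 :+ con 1 in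
           h :+ two :* h :* (two :* ((q :+ δ) :* q)) :+ two :* (h :* h :* (δ :* δ))
           := h :+ two :* h :* (two :* ((q :+ δ) :* q)) :+ two :* h :* (h :* (δ :* δ))) refl ½ q δ ⟩
    ½ + 2# * ½ * (2# * ((q + δ) * q)) + 2# * ½ * (½ * (δ * δ))
      ≈⟨ +-congˡ (trans (*-congʳ 2*½≈1) (*-identityˡ _)) ⟩
    ½ + 2# * ½ * (2# * ((q + δ) * q)) + ½ * (δ * δ)
      ≈⟨ solve 3 (λ h q δ → let two = con 1 :+ con 1 in
           h :+ two :* h :* (two :* ((q :+ δ) :* q)) :+ h :* (δ :* δ)
           := h :* (con 1 :+ (two :* q :+ δ) :* (two :* q :+ δ))) refl ½ q δ ⟩
    ½ * (1# + (s + δ) * (s + δ))      ≈⟨ *-congˡ (+-congˡ (*-cong s+δ≈1 s+δ≈1)) ⟩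
    ½ * (1# + 1# * 1#)                ≈⟨ *-congˡ (+-congˡ (*-identityˡ 1#)) ⟩
    ½ * 2#                            ≈⟨ *-comm ½ 2# ⟩
    2# * ½                            ≈⟨ 2*½≈1 ⟩
    1#                                ∎
    where open ≈-Reasoning

  -- The factors `ρ`, `1# + τ`, `1# + τ` add up to 3, so this is the inequality of arithmetic and
  -- geometric means. With `u = ρ + 2τ = 1` the gap `u³ - ρ (u + τ)²` is `3ρτ² + 8τ³`.
  ρ[1+τ]²≤1 : ρ * ((1# + τ) * (1# + τ)) ≤ 1#
  ρ[1+τ]²≤1 = begin
    ρ * ((1# + τ) * (1# + τ))         ≈⟨ *-congˡ (*-cong (+-congʳ ρ+2τ≈1) (+-congʳ ρ+2τ≈1)) ⟨
    ρ * ((u + τ) * (u + τ))           ≤⟨ x≤x+y _ (+-nonNeg 0≤ρττ (+-nonNeg 0≤ρττ (+-nonNeg 0≤ρττ 0≤8τ³))) ⟩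
    ρ * ((u + τ) * (u + τ)) + (ρ * (τ * τ) + (ρ * (τ * τ) + (ρ * (τ * τ) + 2# * τ * (2# * τ * (2# * τ)))))
      ≈⟨ solve 2 (λ ρ τ → let two = con 1 :+ con 1; u = ρ :+ two :* τ in
           ρ :* ((u :+ τ) :* (u :+ τ)) :+ (ρ :* (τ :* τ) :+ (ρ :* (τ :* τ) :+ (ρ :* (τ :* τ)
             :+ two :* τ :* (two :* τ :* (two :* τ)))))
           := u :* (u :* u)) refl ρ τ ⟩
    u * (u * u)                       ≈⟨ *-cong ρ+2τ≈1 (*-cong ρ+2τ≈1 ρ+2τ≈1) ⟩
    1# * (1# * 1#)                    ≈⟨ trans (*-identityˡ _) (*-identityˡ _) ⟩
    1#                                ∎
    where
    open ≤-Reasoning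
    u = ρ + 2# * τ
    0≤ρττ : 0# ≤ ρ * (τ * τ)
    0≤ρττ = <⇒≤ (*-pos 0<ρ (*-pos 0<τ 0<τ))
    0<2τ : 0# < 2# * τ
    0<2τ = *-pos 0<2 0<τ
    0≤8τ³ : 0# ≤ 2# * τ * (2# * τ * (2# * τ))
    0≤8τ³ = <⇒≤ (*-pos 0<2τ (*-pos 0<2τ 0<2τ))

  -- Comparison through one step of the recurrence.

  mix-mono-≤ : ∀ {x x′ y y′} → x ≤ x′ → y ≤ y′ → p * x + q * y ≤ p * x′ + q * y′
  mix-mono-≤ x≤x′ y≤y′ = +-mono-≤ (*-monoʳ-≤ p (<⇒≤ 0<p) x≤x′) (*-monoʳ-≤ q (<⇒≤ 0<q) y≤y′)

  mix-lower : ∀ {S S₁ S₂ T T₁ T₂} → S ≈ p * S₁ + q * S₂ → T ≈ p * T₁ + q * T₂ →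
              S₁ ≤ T₁ → S₂ ≤ T₂ → S ≤ T
  mix-lower S≈ T≈ S₁≤T₁ S₂≤T₂ = ≤-trans (inj₂ S≈) (≤-trans (mix-mono-≤ S₁≤T₁ S₂≤T₂) (inj₂ (sym T≈)))

  -- The error need not solve the recurrence exactly: a supersolution, `p * b₁ + q * b₂ ≤ b`,
  -- carries the bound from the two successor states to the present one.
  mix-upper : ∀ {S S₁ S₂ T T₁ T₂ b b₁ b₂} → S ≈ p * S₁ + q * S₂ → T ≈ p * T₁ + q * T₂ →
              p * b₁ + q * b₂ ≤ b → T₁ ≤ S₁ + b₁ → T₂ ≤ S₂ + b₂ → T ≤ S + b
  mix-upper {S} {S₁} {S₂} {T} {T₁} {T₂} {b} {b₁} {b₂} S≈ T≈ b≥ T₁≤ T₂≤ = begin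
    T                                           ≈⟨ T≈ ⟩
    p * T₁ + q * T₂                             ≤⟨ mix-mono-≤ T₁≤ T₂≤ ⟩
    p * (S₁ + b₁) + q * (S₂ + b₂)
      ≈⟨ solve 6 (λ p q S₁ b₁ S₂ b₂ → p :* (S₁ :+ b₁) :+ q :* (S₂ :+ b₂)
           := p :* S₁ :+ q :* S₂ :+ (p :* b₁ :+ q :* b₂)) refl p q S₁ b₁ S₂ b₂ ⟩
    p * S₁ + q * S₂ + (p * b₁ + q * b₂)         ≤⟨ +-mono-≤ (inj₂ (sym S≈)) b≥ ⟩
    S + b                                       ∎
    where open ≤-Reasoning

  -- The negative binomial law of B's score in Phase I.

  coefficient : ℕ → ℕ → ℕ
  coefficient k m = (k ℕ.+ m ∸ 1) C m

  coefficient-pascal : ∀ k m → coefficient (suc k) (suc m) ≡.≡ coefficient k (suc m) ℕ.+ coefficient (suc k) m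
  coefficient-pascal k m rewrite +-suc k m =
    ≡.trans (≡.sym (nCk+nC[k+1]≡[n+1]C[k+1] (k ℕ.+ m) m)) (ℕ-+-comm ((k ℕ.+ m) C m) _)

  binomialSum : Carrier → ℕ → Carrier
  binomialSum x n = ∑[ i < n ] let m = toℕ i in fromℕ (coefficient n m) * x ^ m

  -- The factor before `x` is the probability that B scores exactly `m` goals before G's `k`-th
  -- goal.
  negativeBinomialTerm : ℕ → ℕ → Carrier → Carrier
  negativeBinomialTerm k m x = fromℕ (coefficient k m) * (p ^ k * q ^ m) * x

  -- Only scores `m < j` occur: those from which Phase II starts with a positive lead `j ∸ m`.
  negativeBinomialSum : (ℕ → Carrier) → ℕ → ℕ → Carrier
  negativeBinomialSum f k j = ∑[ i < j ] let m = toℕ i in negativeBinomialTerm k m (f (j ∸ m))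

  negativeBinomialTerm-suc : ∀ k m x → negativeBinomialTerm (suc k) (suc m) x ≈
    p * negativeBinomialTerm k (suc m) x + q * negativeBinomialTerm (suc k) m x
  negativeBinomialTerm-suc k m x = begin
    fromℕ (coefficient (suc k) (suc m)) * (p * p ^ k * (q * q ^ m)) * x
      ≈⟨ *-congʳ (*-congʳ (trans (×-congˡ (coefficient-pascal k m))
           (×-homo-+ 1# (coefficient k (suc m)) (coefficient (suc k) m)))) ⟩
    (a + b) * (p * p ^ k * (q * q ^ m)) * x
      ≈⟨ solve 7 (λ a b p q P Q x → (a :+ b) :* (p :* P :* (q :* Q)) :* x
           := p :* (a :* (P :* (q :* Q)) :* x) :+ q :* (b :* (p :* P :* Q) :* x))
           refl a b p q (p ^ k) (q ^ m) x ⟩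
    p * negativeBinomialTerm k (suc m) x + q * negativeBinomialTerm (suc k) m x ∎
    where
    open ≈-Reasoning
    a = fromℕ (coefficient k (suc m))
    b = fromℕ (coefficient (suc k) m)

  -- The same recurrence as that of `valueI`. The term `m = 0` requires the first goal to be G's;
  -- for `m > 0` Pascal's rule splits the term by the first goal, and a goal by B shifts both `m`
  -- and `j` by one.
  negativeBinomialSum-suc : ∀ f k j → negativeBinomialSum f (suc k) (suc j) ≈
    p * negativeBinomialSum f k (suc j) + q * negativeBinomialSum f (suc k) j
  negativeBinomialSum-suc f k j = begin
    negativeBinomialTerm (suc k) 0 x + ∑[ i < j ] negativeBinomialTerm (suc k) (suc (toℕ i)) (f (j ∸ toℕ i))
      ≈⟨ +-cong head (trans (sum-cong-≋ {j} (λ i → negativeBinomialTerm-suc k (toℕ i) _))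
           (trans (∑-distrib-+ {j} _ _)
             (+-cong (sym (*-distribˡ-sum {j} p _)) (sym (*-distribˡ-sum {j} q _))))) ⟩
    p * negativeBinomialTerm k 0 x +
      (p * (∑[ i < j ] negativeBinomialTerm k (suc (toℕ i)) (f (j ∸ toℕ i))) + q * negativeBinomialSum f (suc k) j)
      ≈⟨ trans (sym (+-assoc _ _ _)) (+-congʳ (sym (distribˡ p _ _))) ⟩
    p * negativeBinomialSum f k (suc j) + q * negativeBinomialSum f (suc k) j ∎
    where
    open ≈-Reasoning
    x = f (suc j)
    head : negativeBinomialTerm (suc k) 0 x ≈ p * negativeBinomialTerm k 0 x
    -- Both coefficients compute to 1, and `fromℕ 1` unfolds to `1# + 0#`; hence `con 1 :+ con 0`.
    head = solve 3 (λ p P x → (con 1 :+ con 0) :* (p :* P :* con 1) :* x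
      := p :* ((con 1 :+ con 0) :* (P :* con 1) :* x)) refl p (p ^ k) x

  -- With no goal left for G the law is concentrated at `m = 0`: truncated subtraction makes
  -- `coefficient 0 0` equal to 1, and `coefficient 0 (suc m)` is `m C suc m`, which vanishes.
  negativeBinomialSum-zero : ∀ f j → negativeBinomialSum f 0 (suc j) ≈ f (suc j)
  negativeBinomialSum-zero f j = begin
    negativeBinomialSum f 0 (suc j)
      ≈⟨ +-congˡ (trans (sum-cong-≋ {j} (λ i → vanish (toℕ i) (f (j ∸ toℕ i)))) (sum-replicate-zero j)) ⟩
    negativeBinomialTerm 0 0 (f (suc j)) + 0#
      ≈⟨ solve 1 (λ x → (con 1 :+ con 0) :* (con 1 :* con 1) :* x :+ con 0 := x) refl (f (suc j)) ⟩
    f (suc j) ∎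
    where
    open ≈-Reasoning
    vanish : ∀ m x → negativeBinomialTerm 0 (suc m) x ≈ 0#
    vanish m x = trans (*-congʳ (trans (*-congʳ (×-congˡ (k>n⇒nCk≡0 (n<1+n m)))) (zeroˡ _))) (zeroˡ x)

  -- Since `p * r ≈ q`, the comeback factor turns `n ∸ m` of the factors `p` into `q`. This
  -- exchanges the roles of the teams and produces the powers of `1# - q` in `A` and in the last sum
  -- of `R`.
  exchange : ∀ {m n} → m ℕ.≤ n → p ^ n * q ^ m * r ^ (n ∸ m) ≈ q ^ n * p ^ m
  exchange {m} {n} m≤n = begin
    p ^ n * q ^ m * r ^ j               ≈⟨ *-congʳ (*-congʳ (split p)) ⟩
    p ^ m * p ^ j * q ^ m * r ^ j       ≈⟨ solve 4 (λ Pm Pj Qm Rj → Pm :* Pj :* Qm :* Rj := Qm :* (Pj :* Rj) :* Pm)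
                                             refl (p ^ m) (p ^ j) (q ^ m) (r ^ j) ⟩
    q ^ m * (p ^ j * r ^ j) * p ^ m     ≈⟨ *-congʳ (*-congˡ (trans (sym (^-distrib-* p r j)) (^-congˡ j pr≈q))) ⟩
    q ^ m * q ^ j * p ^ m               ≈⟨ *-congʳ (split q) ⟨
    q ^ n * p ^ m                       ∎
    where
    open ≈-Reasoning
    j = n ∸ m
    split : ∀ x → x ^ n ≈ x ^ m * x ^ j
    split x = trans (^-congʳ x (≡.sym (m+[n∸m]≡n m≤n))) (^-homo-* x m j)

  -- Phase II under an affine weight: exact value and error bound.

  module AffineWeight (α β : Carrier) (0≤α : 0# ≤ α) (0≤β : 0# ≤ β) where

    weight : ℕ → Carrier
    weight d = α + β * fromℕ d

    affine-nonNeg : ∀ {x} → 0# ≤ x → 0# ≤ α + β * x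
    affine-nonNeg 0≤x = +-nonNeg 0≤α (*-nonNeg 0≤β 0≤x)

    affine-mono-≤ : ∀ {x y} → x ≤ y → α + β * x ≤ α + β * y
    affine-mono-≤ x≤y = +-mono-≤ ≤-refl (*-monoʳ-≤ β 0≤β x≤y)

    0≤v*fromℕ : ∀ n → 0# ≤ v * fromℕ n
    0≤v*fromℕ n = *-nonNeg (<⇒≤ 0<v) (fromℕ-nonNeg n)

    -- The walk wins from lead l with probability rˡ; given that, it is the walk
    -- with p and q exchanged, whose mean hitting time is l / (p - q).
    valueII : ℕ → ℕ → Carrier
    valueII l d = r ^ l * (α + β * (fromℕ d + v * fromℕ l))

    valueII-nonNeg : ∀ l d → 0# ≤ valueII l d
    valueII-nonNeg l d = *-nonNeg (<⇒≤ (^-pos 0<r l))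
      (affine-nonNeg (+-nonNeg (fromℕ-nonNeg d) (0≤v*fromℕ l)))

    valueII-tied : ∀ d → valueII 0 d ≈ weight d
    valueII-tied d = trans (*-identityˡ _)
      (+-congˡ (*-congˡ (trans (+-congˡ (zeroʳ v)) (+-identityʳ (fromℕ d)))))

    -- Writing `q` as `p * r` extracts `r ^ suc l` and leaves an average in which lead `suc (suc l)`
    -- has probability `q` and lead `l` has probability `p`.
    valueII-suc : ∀ l d → valueII (suc l) d ≈ p * valueII (suc (suc l)) (suc d) + q * valueII l (suc d)
    valueII-suc l d = sym (begin
      p * valueII (suc (suc l)) (suc d) + q * valueII l (suc d) ≈⟨ +-congˡ (*-congʳ pr≈q) ⟨
      p * valueII (suc (suc l)) (suc d) + p * r * valueII l (suc d)
        ≈⟨ solve 8 (λ p r R α β v d l →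
             p :* (r :* (r :* R) :* (α :+ β :* ((con 1 :+ d) :+ v :* (con 1 :+ (con 1 :+ l)))))
               :+ p :* r :* (R :* (α :+ β :* ((con 1 :+ d) :+ v :* l)))
             := r :* R :* ((p :+ p :* r) :* (α :+ β :* (d :+ v :* l))
                  :+ β :* (p :+ p :* r :+ (con 1 :+ con 1) :* (p :* r) :* v)))
             refl p r (r ^ l) α β v (fromℕ d) (fromℕ l) ⟩
      r * r ^ l * ((p + p * r) * (α + β * (fromℕ d + v * fromℕ l)) + β * (p + p * r + 2# * (p * r) * v))
        ≈⟨ *-congˡ (+-cong (trans (*-congʳ unit) (*-identityˡ _))
             (*-congˡ (trans (+-cong (trans unit (sym δv≈1)) (*-congʳ (*-congˡ pr≈q))) drift))) ⟩
      r * r ^ l * (α + β * (fromℕ d + v * fromℕ l) + β * v)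
        ≈⟨ *-congˡ (solve 5 (λ α β v d l → α :+ β :* (d :+ v :* l) :+ β :* v
             := α :+ β :* (d :+ v :* (con 1 :+ l))) refl α β v (fromℕ d) (fromℕ l)) ⟩
      valueII (suc l) d ∎)
      where
      open ≈-Reasoning
      unit : p + p * r ≈ 1#
      unit = trans (+-congˡ pr≈q) p+q≈1
      -- The goal just scored adds `1# ≈ δ * v`, and the two extra units of lead, reached with
      -- probability `q`, add `2qv = s * v`. Together they are the `v` belonging to one more unit of
      -- lead.
      drift : δ * v + s * v ≈ v
      drift = trans (sym (distribʳ v δ s)) (trans (*-congʳ (trans (+-comm δ s) s+δ≈1)) (*-identityˡ v))

    -- With s = 2q, the factor ρᴺ sˡ satisfies the recurrence of the walk exactly,
    -- because p s² + q = ρ s; d + N is constant along the walk, and the term in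
    -- the lead l does not spoil the inequality because p s² ≤ q.
    errorII : ℕ → ℕ → ℕ → Carrier
    errorII N l d = ρ ^ N * s ^ l * (α + β * (fromℕ d + fromℕ N + v * fromℕ l))

    errorII-nonNeg : ∀ N l d → 0# ≤ errorII N l d
    errorII-nonNeg N l d = *-nonNeg (<⇒≤ (*-pos (^-pos 0<ρ N) (^-pos 0<s l)))
      (affine-nonNeg (+-nonNeg (+-nonNeg (fromℕ-nonNeg d) (fromℕ-nonNeg N)) (0≤v*fromℕ l)))

    errorII-suc : ∀ N l d → p * errorII N (suc (suc l)) (suc d) + q * errorII N l (suc d) ≤ errorII (suc N) (suc l) d
    errorII-suc N l d = begin
      p * errorII N (suc (suc l)) (suc d) + q * errorII N l (suc d)
        -- The added term is the slack `q - p s² = q δ²` in the part linear in the lead; with it the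
        -- inequality becomes an identity.
        ≤⟨ x≤x+y _ (*-nonNeg (<⇒≤ (*-pos (^-pos 0<ρ N) (^-pos 0<s l)))
             (*-nonNeg (*-nonNeg 0≤β (<⇒≤ 0<v)) (<⇒≤ (*-pos 0<q (*-pos 0<δ 0<δ))))) ⟩
      p * errorII N (suc (suc l)) (suc d) + q * errorII N l (suc d) + P * L * (β * v * (q * (δ * δ)))
        ≈⟨ solve 11 (λ p q s e P L X β v n l →
             p :* (P :* (s :* (s :* L)) :* (X :+ β :* (n :+ v :* (con 1 :+ (con 1 :+ l))))) :+ q :* (P :* L :* (X :+ β :* (n :+ v :* l)))
               :+ P :* L :* (β :* v :* e)
             := P :* L :* ((p :* (s :* s) :+ q) :* (X :+ β :* (n :+ v :* l))
                  :+ β :* v :* (p :* (s :* s) :+ (p :* (s :* s) :+ e))))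
             refl p q s (q * (δ * δ)) P L α β v (1# + fromℕ d + fromℕ N) (fromℕ l) ⟩
      P * L * ((p * (s * s) + q) * Y + β * v * (p * (s * s) + (p * (s * s) + q * (δ * δ))))
        ≈⟨ *-congˡ (+-cong (*-congʳ (sym ρs≈ps²+q))
             (*-congˡ (trans (+-congˡ (sym q≈ps²+qδ²)) (sym ρs≈ps²+q)))) ⟩
      P * L * (ρ * s * Y + β * v * (ρ * s))
        ≈⟨ solve 10 (λ ρ s P L α β v l d n →
             P :* L :* (ρ :* s :* (α :+ β :* (con 1 :+ d :+ n :+ v :* l)) :+ β :* v :* (ρ :* s))
             := ρ :* P :* (s :* L) :* (α :+ β :* (d :+ (con 1 :+ n) :+ v :* (con 1 :+ l))))
             refl ρ s P L α β v (fromℕ l) (fromℕ d) (fromℕ N) ⟩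
      errorII (suc N) (suc l) d ∎
      where
      open ≤-Reasoning
      P = ρ ^ N
      L = s ^ l
      Y = α + β * (1# + fromℕ d + fromℕ N + v * fromℕ l)

    phaseIISum≤valueII : ∀ N l d → phaseIISum q weight l d N ≤ valueII l d
    phaseIISum≤valueII zero    l       d = valueII-nonNeg l d
    phaseIISum≤valueII (suc N) zero    d =
      inj₂ (trans (phaseIISum-tied q weight d N) (sym (valueII-tied d)))
    phaseIISum≤valueII (suc N) (suc l) d =
      mix-lower (phaseIISum-suc q weight l d N) (valueII-suc l d)
        (phaseIISum≤valueII N (suc (suc l)) (suc d)) (phaseIISum≤valueII N l (suc d))

    valueII≤phaseIISum+errorII : ∀ N l d → valueII l d ≤ phaseIISum q weight l d N + errorII N l d
    valueII≤phaseIISum+errorII zero    l       d = begin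
      r ^ l * (α + β * (fromℕ d + v * fromℕ l))
        -- Nothing has been summed yet, so the error must dominate the whole value; `r ≤ s` ensures
        -- this.
        ≤⟨ *-monoˡ-≤ _ (affine-nonNeg (+-nonNeg (fromℕ-nonNeg d) (0≤v*fromℕ l))) (^-mono-≤ 0<r r≤s l) ⟩
      s ^ l * (α + β * (fromℕ d + v * fromℕ l))
        ≈⟨ solve 6 (λ S α β v d l → S :* (α :+ β :* (d :+ v :* l))
             := con 0 :+ con 1 :* S :* (α :+ β :* (d :+ con 0 :+ v :* l)))
             refl (s ^ l) α β v (fromℕ d) (fromℕ l) ⟩
      0# + errorII 0 l d ∎
      where open ≤-Reasoning
    valueII≤phaseIISum+errorII (suc N) zero    d =
      ≤-trans (inj₂ (trans (valueII-tied d) (sym (phaseIISum-tied q weight d N))))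
              (x≤x+y _ (errorII-nonNeg (suc N) 0 d))
    valueII≤phaseIISum+errorII (suc N) (suc l) d =
      mix-upper (phaseIISum-suc q weight l d N) (valueII-suc l d) (errorII-suc N l d)
        (valueII≤phaseIISum+errorII N (suc (suc l)) (suc d)) (valueII≤phaseIISum+errorII N l (suc d))

    -- Phase I: value, error bound and convergence.

    -- valueI k j: G still needs k goals, and Phase II would start with lead j if
    -- B did not score any more.
    valueI : ℕ → ℕ → Carrier
    valueI zero    j       = valueII j 0
    valueI (suc k) zero    = α
    valueI (suc k) (suc j) = p * valueI k (suc j) + q * valueI (suc k) j

    -- B already has at least `n` goals: the win is certain and Phase II has duration 0, of weight
    -- `α`.
    valueI-tied : ∀ k → valueI k 0 ≈ α
    valueI-tied zero    = trans (valueII-tied 0) (trans (+-congˡ (zeroʳ β)) (+-identityʳ α))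
    valueI-tied (suc k) = refl

    mix-constant : ∀ x → p * x + q * x ≈ x
    mix-constant x = trans (sym (distribʳ x p q)) (trans (*-congʳ p+q≈1) (*-identityˡ x))

    -- With `pred` the recurrence covers lead 0 as well, where further goals by B leave `n ∸ m` at 0
    -- and the value stays `α`.
    valueI-suc : ∀ k j → valueI (suc k) j ≈ p * valueI k j + q * valueI (suc k) (pred j)
    valueI-suc k zero    = sym (trans (+-congʳ (*-congˡ (valueI-tied k))) (mix-constant α))
    valueI-suc k (suc j) = refl

    valueI-nonNeg : ∀ k j → 0# ≤ valueI k j
    valueI-nonNeg zero    j       = valueII-nonNeg j 0
    valueI-nonNeg (suc k) zero    = 0≤α
    valueI-nonNeg (suc k) (suc j) = ≤-trans (inj₂ (sym (trans (+-cong (zeroʳ p) (zeroʳ q)) (+-identityˡ 0#))))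
      (mix-mono-≤ (valueI-nonNeg k (suc j)) (valueI-nonNeg (suc k) j))

    valueI-pos : 0# < α → ∀ k j → 0# < valueI k j
    valueI-pos 0<α zero    j       = *-pos (^-pos 0<r j) (begin-strict
      0# <⟨ 0<α ⟩
      α  ≤⟨ x≤x+y α (*-nonNeg 0≤β (+-nonNeg ≤-refl (0≤v*fromℕ j))) ⟩
      α + β * (0# + v * fromℕ j) ∎)
      where open ≤-Reasoning
    valueI-pos 0<α (suc k) zero    = 0<α
    valueI-pos 0<α (suc k) (suc j) =
      +-pos (*-pos 0<p (valueI-pos 0<α k (suc j))) (*-pos 0<q (valueI-pos 0<α (suc k) j))

    growth : ℕ → ℕ → Carrier
    growth N j = α + β * (fromℕ N + v * fromℕ j)

    growth-nonNeg : ∀ N j → 0# ≤ growth N j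
    growth-nonNeg N j = affine-nonNeg (+-nonNeg (fromℕ-nonNeg N) (0≤v*fromℕ j))

    growth-mono-≤ : ∀ {M N i j} → M ℕ.≤ N → i ℕ.≤ j → growth M i ≤ growth N j
    growth-mono-≤ M≤N i≤j = affine-mono-≤
      (+-mono-≤ (fromℕ-mono-≤ M≤N) (*-monoʳ-≤ v (<⇒≤ 0<v) (fromℕ-mono-≤ i≤j)))

    s^n≤1 : ∀ n → s ^ n ≤ 1#
    s^n≤1 n = ≤-trans (^-mono-≤ 0<s s≤1 n) (inj₂ (1^n≈1 n))

    r^n≤1 : ∀ n → r ^ n ≤ 1#
    r^n≤1 n = ≤-trans (^-mono-≤ 0<r r≤s n) (s^n≤1 n)

    valueI≤growth : ∀ k j → valueI k j ≤ growth 0 j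
    valueI≤growth zero    j       =
      ≤-trans (*-monoˡ-≤ _ (growth-nonNeg 0 j) (r^n≤1 j)) (inj₂ (*-identityˡ _))
    valueI≤growth (suc k) zero    = x≤x+y α (*-nonNeg 0≤β (+-nonNeg ≤-refl (0≤v*fromℕ 0)))
    valueI≤growth (suc k) (suc j) = begin
      p * valueI k (suc j) + q * valueI (suc k) j
        ≤⟨ mix-mono-≤ (valueI≤growth k (suc j)) (≤-trans (valueI≤growth (suc k) j) (growth-mono-≤ {0} {0} z≤n (n≤1+n j))) ⟩
      p * growth 0 (suc j) + q * growth 0 (suc j) ≈⟨ mix-constant _ ⟩
      growth 0 (suc j) ∎
      where open ≤-Reasoning

    -- The factor 2ᵏ bounds the tail of the waiting time for G's goals: p + 2q ≤ 2ρ.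
    errorI : ℕ → ℕ → ℕ → Carrier
    errorI N k j = 2# ^ k * (ρ ^ N * growth N j)

    1≤2^ : ∀ k → 1# ≤ 2# ^ k
    1≤2^ k = ≤-trans (inj₂ (sym (1^n≈1 k))) (^-mono-≤ 0<1 (x≤x+y 1# (<⇒≤ 0<1)) k)

    errorI-suc : ∀ N k j → p * errorI N k j + q * errorI N (suc k) (pred j) ≤ errorI (suc N) (suc k) j
    errorI-suc N k j = begin
      p * errorI N k j + q * errorI N (suc k) (pred j)
        ≤⟨ +-mono-≤ ≤-refl (*-monoʳ-≤ q (<⇒≤ 0<q) (*-monoʳ-≤ _ (<⇒≤ (^-pos 0<2 (suc k)))
             (*-monoʳ-≤ _ (<⇒≤ (^-pos 0<ρ N)) (growth-mono-≤ {N} {N} {_} {j} ℕ-≤-refl pred[n]≤n)))) ⟩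
      p * errorI N k j + q * errorI N (suc k) j
        ≈⟨ solve 5 (λ p q K P g → p :* (K :* (P :* g)) :+ q :* ((con 1 :+ con 1) :* K :* (P :* g))
             := (p :+ (con 1 :+ con 1) :* q) :* (K :* (P :* g))) refl p q (2# ^ k) (ρ ^ N) (growth N j) ⟩
      (p + 2# * q) * errorI N k j
        ≤⟨ *-mono-≤ (<⇒≤ (*-pos 0<2 0<ρ)) 0≤e p+2q≤2ρ
             (*-monoʳ-≤ _ (<⇒≤ (^-pos 0<2 k)) (*-monoʳ-≤ _ (<⇒≤ (^-pos 0<ρ N))
               (growth-mono-≤ {_} {_} {j} (n≤1+n N) ℕ-≤-refl))) ⟩
      2# * ρ * (2# ^ k * (ρ ^ N * growth (suc N) j))
        ≈⟨ solve 5 (λ t ρ K P g → t :* ρ :* (K :* (P :* g)) := t :* K :* (ρ :* P :* g))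
             refl 2# ρ (2# ^ k) (ρ ^ N) (growth (suc N) j) ⟩
      errorI (suc N) (suc k) j ∎
      where
      open ≤-Reasoning
      0≤e : 0# ≤ errorI N k j
      0≤e = *-nonNeg (<⇒≤ (^-pos 0<2 k)) (*-nonNeg (<⇒≤ (^-pos 0<ρ N)) (growth-nonNeg N j))

    valueI-phaseI : ∀ n k m → valueI (suc k) (n ∸ m) ≈
      p * valueI k (n ∸ m) + q * valueI (suc k) (n ∸ suc m)
    valueI-phaseI n k m = ≡.subst (λ j → valueI (suc k) (n ∸ m) ≈ p * valueI k (n ∸ m) + q * valueI (suc k) j)
      (pred[m∸n]≡m∸[1+n] n m) (valueI-suc k (n ∸ m))

    phaseISum≤valueI : ∀ n N k m → phaseISum q weight n k m N ≤ valueI k (n ∸ m)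
    phaseISum≤valueI n zero    k       m = valueI-nonNeg k (n ∸ m)
    phaseISum≤valueI n (suc N) zero    m = phaseIISum≤valueII (suc N) (n ∸ m) 0
    phaseISum≤valueI n (suc N) (suc k) m =
      mix-lower (phaseISum-suc q weight n k m N) (valueI-phaseI n k m)
        (phaseISum≤valueI n N k m) (phaseISum≤valueI n N (suc k) (suc m))

    valueI≤phaseISum+errorI : ∀ n N k m →
      valueI k (n ∸ m) ≤ phaseISum q weight n k m N + errorI N k (n ∸ m)
    valueI≤phaseISum+errorI n zero    k       m = begin
      valueI k j                    ≤⟨ valueI≤growth k j ⟩
      growth 0 j                    ≈⟨ *-identityˡ _ ⟨
      1# * growth 0 j               ≤⟨ *-monoˡ-≤ _ (growth-nonNeg 0 j) (1≤2^ k) ⟩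
      2# ^ k * growth 0 j           ≈⟨ trans (+-identityˡ _) (*-congˡ (*-identityˡ _)) ⟨
      0# + 2# ^ k * (1# * growth 0 j) ∎
      where
      open ≤-Reasoning
      j = n ∸ m
    valueI≤phaseISum+errorI n (suc N) zero    m =
      -- Phase I is over, so the bound for Phase II applies; `s ^ j ≤ 1#` reduces its error to
      -- `errorI` with `k = 0`.
      ≤-trans (valueII≤phaseIISum+errorII (suc N) j 0) (+-mono-≤ ≤-refl (begin
        ρ ^ suc N * s ^ j * (α + β * (0# + fromℕ (suc N) + v * fromℕ j))
          ≈⟨ *-congˡ (+-congˡ (*-congˡ (+-congʳ (+-identityˡ _)))) ⟩
        ρ ^ suc N * s ^ j * growth (suc N) j
          ≤⟨ *-monoˡ-≤ _ (growth-nonNeg (suc N) j) (*-monoʳ-≤ _ (<⇒≤ (^-pos 0<ρ (suc N))) (s^n≤1 j)) ⟩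
        ρ ^ suc N * 1# * growth (suc N) j
          ≈⟨ trans (*-congʳ (*-identityʳ _)) (sym (*-identityˡ _)) ⟩
        errorI (suc N) 0 j ∎))
      where
      open ≤-Reasoning
      j = n ∸ m
    valueI≤phaseISum+errorI n (suc N) (suc k) m =
      mix-upper (phaseISum-suc q weight n k m N) (valueI-phaseI n k m)
        (≡.subst (λ j → p * errorI N k (n ∸ m) + q * errorI N (suc k) j ≤ errorI (suc N) (suc k) (n ∸ m))
          (pred[m∸n]≡m∸[1+n] n m) (errorI-suc N k (n ∸ m)))
        (valueI≤phaseISum+errorI n N k m) (valueI≤phaseISum+errorI n N (suc k) (suc m))

    -- `growth N j` is `growth 0 j + β N`, and `N = (N τ) t` for the inverse `t` of `τ`. Hence it is
    -- at most `(growth 0 j + β t) (1 + N τ)`, a linear factor that the geometric decay absorbs.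
    errorI-null : ∀ k j → Null (λ N → errorI N k j)
    errorI-null k j = null-of-geometric {K = K} 0<ρ 0<τ
      (*-nonNeg (<⇒≤ (^-pos 0<2 k)) (+-nonNeg (growth-nonNeg 0 j) 0≤βt)) ρ[1+τ]²≤1 λ N → begin
        2# ^ k * (ρ ^ N * growth N j)
          ≤⟨ x≤x+y _ (*-nonNeg (<⇒≤ (*-pos (^-pos 0<2 k) (^-pos 0<ρ N)))
               (+-nonNeg 0≤βt (*-nonNeg (growth-nonNeg 0 j) (*-nonNeg (fromℕ-nonNeg N) (<⇒≤ 0<τ))))) ⟩
        2# ^ k * (ρ ^ N * growth N j) + 2# ^ k * ρ ^ N * (β * t + growth 0 j * (fromℕ N * τ))
          ≈⟨ solve 8 (λ P T α β N τ t c →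
               T :* (P :* (α :+ β :* (N :+ c))) :+ T :* P :* (β :* t :+ (α :+ β :* (con 0 :+ c)) :* (N :* τ))
               := P :* T :* ((α :+ β :* (con 0 :+ c)) :* (con 1 :+ N :* τ) :+ β :* t :+ β :* N :* con 1))
               refl (ρ ^ N) (2# ^ k) α β (fromℕ N) τ t (v * fromℕ j) ⟩
        ρ ^ N * 2# ^ k * (growth 0 j * (1# + fromℕ N * τ) + β * t + β * fromℕ N * 1#)
          ≈⟨ *-congˡ (+-congˡ (*-congˡ τt≈1)) ⟨
        ρ ^ N * 2# ^ k * (growth 0 j * (1# + fromℕ N * τ) + β * t + β * fromℕ N * (τ * t))
          ≈⟨ solve 7 (λ P T g β N τ t →
               P :* T :* (g :* (con 1 :+ N :* τ) :+ β :* t :+ β :* N :* (τ :* t))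
               := P :* (T :* (g :+ β :* t) :* (con 1 :+ N :* τ)))
               refl (ρ ^ N) (2# ^ k) (growth 0 j) β (fromℕ N) τ t ⟩
        ρ ^ N * (K * (1# + fromℕ N * τ)) ∎
      where
      open ≤-Reasoning
      t = proj₁ (#⇒invertible {τ} {0#} (inj₂ 0<τ))
      τt≈1 : τ * t ≈ 1#
      τt≈1 = *-inverseʳ (inj₂ 0<τ)
      0≤βt : 0# ≤ β * t
      0≤βt = *-nonNeg 0≤β (<⇒≤ (inverse-pos 0<τ τt≈1))
      K = 2# ^ k * (growth 0 j + β * t)

    winDuration-hasSum : ∀ n → HasSum (weighted q weight (winDuration n)) (valueI n n)
    winDuration-hasSum n = squeeze (λ N → phaseISum≤valueI n N n 0)
      (λ N → valueI≤phaseISum+errorI n N n 0) (errorI-null n n)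

    -- Closed form of the value.

    -- Conditioning on the number m of goals B scores in Phase I.  The mass of m ≥ j
    -- is one minus the rest; the rest is moved to the left so that no subtraction
    -- occurs.
    valueI-closed : ∀ k j → valueI k j + α * negativeBinomialSum (λ _ → 1#) k j ≈
                            negativeBinomialSum (λ i → valueII i 0) k j + α
    valueI-closed zero    zero    = trans (+-congʳ (valueI-tied 0))
      (trans (+-congˡ (zeroʳ α)) (+-comm α 0#))
    valueI-closed zero    (suc j) = +-cong (sym (negativeBinomialSum-zero (λ i → valueII i 0) j))
      (trans (*-congˡ (negativeBinomialSum-zero (λ _ → 1#) j)) (*-identityʳ α))
    valueI-closed (suc k) zero    = trans (+-congˡ (zeroʳ α)) (+-comm α 0#)
    valueI-closed (suc k) (suc j) = begin
      p * U₁ + q * U₂ + α * negativeBinomialSum (λ _ → 1#) (suc k) (suc j)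
        ≈⟨ +-congˡ (*-congˡ (negativeBinomialSum-suc (λ _ → 1#) k j)) ⟩
      p * U₁ + q * U₂ + α * (p * W₁ + q * W₂)
        ≈⟨ solve 7 (λ p q α U₁ U₂ W₁ W₂ → p :* U₁ :+ q :* U₂ :+ α :* (p :* W₁ :+ q :* W₂)
             := p :* (U₁ :+ α :* W₁) :+ q :* (U₂ :+ α :* W₂)) refl p q α U₁ U₂ W₁ W₂ ⟩
      p * (U₁ + α * W₁) + q * (U₂ + α * W₂)
        ≈⟨ +-cong (*-congˡ (valueI-closed k (suc j))) (*-congˡ (valueI-closed (suc k) j)) ⟩
      p * (V₁ + α) + q * (V₂ + α)
        ≈⟨ solve 5 (λ p q α V₁ V₂ → p :* (V₁ :+ α) :+ q :* (V₂ :+ α)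
             := p :* V₁ :+ q :* V₂ :+ (p :* α :+ q :* α)) refl p q α V₁ V₂ ⟩
      p * V₁ + q * V₂ + (p * α + q * α)
        ≈⟨ +-cong (sym (negativeBinomialSum-suc (λ i → valueII i 0) k j)) (mix-constant α) ⟩
      negativeBinomialSum (λ i → valueII i 0) (suc k) (suc j) + α ∎
      where
      open ≈-Reasoning
      U₁ = valueI k (suc j)
      U₂ = valueI (suc k) j
      W₁ = negativeBinomialSum (λ _ → 1#) k (suc j)
      W₂ = negativeBinomialSum (λ _ → 1#) (suc k) j
      V₁ = negativeBinomialSum (λ i → valueII i 0) k (suc j)
      V₂ = negativeBinomialSum (λ i → valueII i 0) (suc k) j

    affineSum : ℕ → Carrier
    affineSum n = ∑[ i < n ] let m = toℕ i in
      fromℕ (coefficient n m) * p ^ m * (α + β * (v * fromℕ (n ∸ m)))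

    -- `valueI-closed` at `k = j = n`, with the powers of `r` removed termwise by `exchange`.
    valueI-formula : ∀ n → valueI n n + α * (p ^ n * binomialSum q n) ≈ q ^ n * affineSum n + α
    valueI-formula n = begin
      valueI n n + α * (p ^ n * binomialSum q n)
        ≈⟨ +-congˡ (*-congˡ (trans (*-distribˡ-sum {n} _ _) (sum-cong-≋ {n} λ i →
             solve 3 (λ P c Q → P :* (c :* Q) := c :* (P :* Q) :* con 1)
               refl (p ^ n) (fromℕ (coefficient n (toℕ i))) (q ^ toℕ i)))) ⟩
      valueI n n + α * negativeBinomialSum (λ _ → 1#) n n ≈⟨ valueI-closed n n ⟩
      negativeBinomialSum (λ i → valueII i 0) n n + α
        ≈⟨ +-congʳ (trans (sum-cong-≋ {n} (λ i → term (toℕ i) (ℕ-<⇒≤ (toℕ<n i)))) (sym (*-distribˡ-sum {n} _ _))) ⟩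
      q ^ n * affineSum n + α ∎
      where
      open ≈-Reasoning
      term : ∀ m → m ℕ.≤ n →
        fromℕ (coefficient n m) * (p ^ n * q ^ m) * valueII (n ∸ m) 0 ≈
        q ^ n * (fromℕ (coefficient n m) * p ^ m * (α + β * (v * fromℕ (n ∸ m))))
      term m m≤n = begin
        κ * (p ^ n * q ^ m) * (r ^ (n ∸ m) * (α + β * (0# + y)))
          ≈⟨ solve 7 (λ κ P Q S α β y → κ :* (P :* Q) :* (S :* (α :+ β :* (con 0 :+ y)))
               := (P :* Q :* S) :* (κ :* (α :+ β :* y))) refl κ (p ^ n) (q ^ m) (r ^ (n ∸ m)) α β y ⟩
        p ^ n * q ^ m * r ^ (n ∸ m) * (κ * (α + β * y)) ≈⟨ *-congʳ (exchange m≤n) ⟩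
        q ^ n * p ^ m * (κ * (α + β * y))
          ≈⟨ solve 4 (λ Q P κ y → Q :* P :* (κ :* y) := Q :* (κ :* P :* y))
               refl (q ^ n) (p ^ m) κ (α + β * y) ⟩
        q ^ n * (κ * p ^ m * (α + β * y)) ∎
        where
        κ = fromℕ (coefficient n m)
        y = v * fromℕ (n ∸ m)

  -- Winning probability, restricted duration and their quotient.

  win-hasSum : ∀ n → HasSum (winTerm q n) (R q n) × 0# < R q n
  win-hasSum n = HasSum-cong term (⟶-cong (λ _ → refl) value≈R (winDuration-hasSum n))
               , <-respʳ-≈ value≈R (valueI-pos 0<1 n n)
    where
    open AffineWeight 1# 0# (<⇒≤ 0<1) ≤-refl
    term : ∀ h → weighted q weight (winDuration n) h ≈ winTerm q n h
    term h with winDuration n h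
    ... | just d  = trans (*-congˡ (trans (+-congˡ (zeroˡ _)) (+-identityʳ 1#))) (*-identityʳ _)
    ... | nothing = refl

    y = p ^ n * binomialSum q n
    z = q ^ n * binomialSum p n

    z≈ : q ^ n * affineSum n ≈ z
    z≈ = *-congˡ (sum-cong-≋ {n} (λ i →
      trans (*-congˡ (trans (+-congˡ (zeroˡ _)) (+-identityʳ 1#))) (*-identityʳ _)))

    value≈R : valueI n n ≈ R q n
    -- `R` subtracts `y`, whereas `valueI-formula` adds it on the left; so `y` is added to both
    -- sides and cancelled.
    value≈R = +-cancelʳ y _ _ (begin
      valueI n n + y            ≈⟨ +-congˡ (*-identityˡ y) ⟨
      valueI n n + 1# * y       ≈⟨ valueI-formula n ⟩
      q ^ n * affineSum n + 1#  ≈⟨ +-congʳ z≈ ⟩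
      z + 1#                    ≈⟨ +-congˡ (x+[y-x]≈y y 1#) ⟨
      z + (y + (1# - y))        ≈⟨ solve 3 (λ z y d → z :+ (y :+ d) := d :+ z :+ y) refl z y (1# - y) ⟩
      1# - y + z + y            ∎)
      where open ≈-Reasoning

  duration-hasSum : ∀ n → HasSum (durationTerm q n) (A q q<½ n)
  duration-hasSum n = HasSum-cong term (⟶-cong (λ _ → refl) value≈A (winDuration-hasSum n))
    where
    open AffineWeight 0# 1# ≤-refl (<⇒≤ 0<1)
    term : ∀ h → weighted q weight (winDuration n) h ≈ durationTerm q n h
    term h with winDuration n h
    ... | just d  = *-congˡ (trans (+-identityˡ _) (*-identityˡ _))
    ... | nothing = refl

    value≈A : valueI n n ≈ A q q<½ n
    value≈A = begin
      valueI n n                   ≈⟨ +-identityʳ _ ⟨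
      -- With `α = 0#` the wins at the end of Phase I carry no weight, so the correction term of
      -- `valueI-formula` vanishes.
      valueI n n + 0#              ≈⟨ +-congˡ (zeroˡ _) ⟨
      valueI n n + 0# * (p ^ n * binomialSum q n) ≈⟨ valueI-formula n ⟩
      q ^ n * affineSum n + 0#     ≈⟨ +-identityʳ _ ⟩
      q ^ n * affineSum n          ≈⟨ *-congˡ (trans (sum-cong-≋ {n} (λ i →
            solve 4 (λ κ P v y → κ :* P :* (con 0 :+ con 1 :* (v :* y)) := v :* (κ :* P :* y))
              refl (fromℕ (coefficient n (toℕ i))) (p ^ toℕ i) v (fromℕ (n ∸ toℕ i))))
            (sym (*-distribˡ-sum {n} v (λ i → let m = toℕ i in
              fromℕ (coefficient n m) * p ^ m * fromℕ (n ∸ m))))) ⟩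
      q ^ n * (v * _)              ≈⟨ *-assoc _ _ _ ⟨
      A q q<½ n                    ∎
      where open ≈-Reasoning

  R#0 : ∀ n → R q n # 0#
  R#0 n = inj₂ (proj₂ (win-hasSum n))

  -- Forwards, uniqueness of limits identifies whatever sums the record holds with `R` and `A`;
  -- backwards, `R` and `A` serve as the sums. The equivalence thus contains existence as well as
  -- uniqueness of the conditional expectation.
  conditionalExpectedDuration : ∀ n e →
    IsConditionalExpectedDuration q n e ⇔ e ≈ A q q<½ n / R q n [ R#0 n ]
  conditionalExpectedDuration n e = mk⇔
    (λ E → let open IsConditionalExpectedDuration E in
      trans e≈𝔼/ℙ (/-cong ℙ[win]#0 (R#0 n)
        (⟶-unique 𝔼-hasSum (duration-hasSum n)) (⟶-unique ℙ-hasSum (proj₁ (win-hasSum n)))))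
    (λ e≈A/R → record
      { ℙ-hasSum = proj₁ (win-hasSum n)
      ; 𝔼-hasSum = duration-hasSum n
      ; ℙ[win]#0 = R#0 n
      ; e≈𝔼/ℙ    = e≈A/R
      })

theorem3 : ∀ {c ℓ₁ ℓ₂} (ℝ : RealField c ℓ₁ ℓ₂) → let open TwoPhaseGame ℝ in
    (q : Carrier) → 0# < q → (q<½ : q < ½) → (n : ℕ) → .{{_ : NonZero n}} →
    Σ[ R#0 ∈ R q n # 0# ] (∀ e →
    IsConditionalExpectedDuration q n e ⇔ e ≈ A q q<½ n / R q n [ R#0 ])
theorem3 ℝ q 0<q q<½ n = R#0 n , conditionalExpectedDuration n
  where open WinningGame ℝ q 0<q q<½
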